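{- Let $k\in\mathbb{N}$ and let $D_1,\dots,D_k$ be oriented graphs such that $\operatorname{inv}(D_i)\leq 2$ for all $i$, with equality for at most one $i$. Then \[\operatorname{inv}([D_1,\dots,D_k])=\sum_{i=1}^k\operatorname{inv}(D_i).\]
   Context: All digraphs are oriented graphs: directed graphs without loops, digons or parallel edges. For a digraph $D$ and $X\subseteq V(D)$, inverting $X$ in $D$ means reversing the direction of every edge with both endpoints in $X$. A family $X_1,\dots,X_k\subseteq V(D)$ is a decycling family of $D$ if inverting $X_1,\dots,X_k$ in turn yields an acyclic digraph; $\operatorname{inv}(D)$ is the minimum size of a decycling family of $D$. The $k$-join $[D_1,\dots,D_k]$ is the digraph consisting of vertex-disjoint copies of $D_1,\dots,D_k$ together with an edge $\vec{uv}$ whenever $u\in V(D_i)$, $v\in V(D_j)$ with $i<j$. -}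

module Defs where

open import Data.Nat using (ℕ; zero; suc; _+_; _≤_; _<ᵇ_)
open import Data.Fin using (Fin; splitAt; toℕ; _≟_) renaming (zero to fzero; suc to fsuc)
open import Data.Bool using (Bool; true; false; _∧_; if_then_else_; T)
open import Data.List using (List; []; _∷_; _++_; [_]; length)
open import Data.List.Relation.Unary.Unique.Propositional using (Unique)
open import Data.Product using (Σ; _×_; _,_; proj₁; proj₂)
open import Data.Sum using (inj₁; inj₂)
open import Data.Unit using (⊤)
open import Relation.Nullary using (¬_; yes; no)
open import Relation.Binary.PropositionalEquality using (_≡_; refl)

record Digraph : Set where
  field
    n : ℕ
    E : Fin n → Fin n → Bool
open Digraph public

-- Oriented graph: no loops, no digons (parallel edges are impossible for a relation).
Oriented : Digraph → Set
Oriented D = (∀ v → E D v v ≡ false) × (∀ u v → E D u v ≡ true → E D v u ≡ false)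

Consecutive : ∀ {m} → (Fin m → Fin m → Bool) → List (Fin m) → Set
Consecutive e [] = ⊤
Consecutive e (x ∷ []) = ⊤
Consecutive e (x ∷ y ∷ rest) = T (e x y) × Consecutive e (y ∷ rest)

IsCycle : (D : Digraph) → List (Fin (n D)) → Set
IsCycle D [] = Data.Empty.⊥ where import Data.Empty
IsCycle D (v ∷ vs) = Unique (v ∷ vs) × Consecutive (E D) ((v ∷ vs) ++ [ v ])

Acyclic : Digraph → Set
Acyclic D = ∀ (cs : List (Fin (n D))) → ¬ IsCycle D cs

Subset : Digraph → Set
Subset D = Fin (n D) → Bool

invert : (D : Digraph) → Subset D → Digraph
invert D X = record
  { n = n D
  ; E = λ u v → if X u ∧ X v then E D v u else E D u v }

invertAll : (D : Digraph) → List (Subset D) → Digraph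
invertAll D [] = D
invertAll D (X ∷ Xs) = invertAll (invert D X) Xs

Decycling : (D : Digraph) → List (Subset D) → Set
Decycling D Xs = Acyclic (invertAll D Xs)

IsInv : Digraph → ℕ → Set
IsInv D m =
  Σ (List (Subset D)) (λ Xs → length Xs ≡ m × Decycling D Xs)
  × (∀ (Xs : List (Subset D)) → Decycling D Xs → m ≤ length Xs)

sumF : (k : ℕ) → (Fin k → ℕ) → ℕ
sumF zero f = 0
sumF (suc k) f = f fzero + sumF k (λ i → f (fsuc i))

decode : (k : ℕ) (f : Fin k → ℕ) → Fin (sumF k f) → Σ (Fin k) (λ i → Fin (f i))
decode (suc k) f x with splitAt (f fzero) x
... | inj₁ a = fzero , a
... | inj₂ b with decode k (λ i → f (fsuc i)) b
...   | i , c = fsuc i , c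

joinEdge : (k : ℕ) (Ds : Fin k → Digraph) →
           Σ (Fin k) (λ i → Fin (n (Ds i))) → Σ (Fin k) (λ i → Fin (n (Ds i))) → Bool
joinEdge k Ds (i , a) (j , b) with i ≟ j
... | yes refl = E (Ds i) a b
... | no _ = toℕ i <ᵇ toℕ j

join : (k : ℕ) → (Fin k → Digraph) → Digraph
join k Ds = record
  { n = sumF k (λ i → n (Ds i))
  ; E = λ x y → joinEdge k Ds (decode k (λ i → n (Ds i)) x) (decode k (λ i → n (Ds i)) y) }

module Submission where

-- Give every vertex v the vector x_v over F₂ whose coordinates record membership in the inverted sets,
-- so that an edge uv ends up reversed iff ⟨x_u, x_v⟩ = 1, and list the vertices in an order of the
-- final acyclic digraph. For u, v in one block and w in another, ⟨x_u + x_v, x_w⟩ = 1 iff w lies between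
-- u and v. A block that is not acyclic contains vertices p < q < r with ⟨x_q + x_r, x_p⟩ = 1; ordering
-- the blocks by p makes the matrix of all ⟨x_q + x_r, x_p'⟩ unitriangular, so there are at least as many
-- sets as non-acyclic blocks. In the case of equality the block with the highest p has a vector
-- z = x_q + x_r with ⟨z, z⟩ = 1 that is orthogonal to all other blocks, so passing to the complement of z
-- removes that block and lowers the rank by one. Doing this until the block D with inv(D) = 2 is the
-- highest one shows that inverting {u : ⟨x_u, z⟩ = 1} in D leaves an acyclic digraph, a contradiction.

open import Defs
open import Algebra using (CommutativeRing)
open import Data.Bool using (Bool; true; false; not; _∧_; _xor_; if_then_else_; T)
open import Data.Bool.Properties
  using (xor-comm; xor-assoc; ∧-comm; ∧-distribʳ-xor; T-≡; ¬-not; xor-∧-commutativeRing; xor-annihilates-not; not-involutive)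
  renaming (_≟_ to _≟ᵇ_)
open import Algebra.Properties.CommutativeSemigroup
  (CommutativeRing.+-commutativeSemigroup xor-∧-commutativeRing) using () renaming (interchange to xor-interchange)
open import Data.Empty using (⊥; ⊥-elim)
open import Data.Fin using (Fin; toℕ; punchIn; punchOut; _↑ˡ_; _↑ʳ_; _≟_) renaming (suc to fsuc)
open import Data.Fin.Patterns using (0F; 1F; 2F)
open import Data.Fin.Properties as Fin
  using (any?; all?; ¬∀⟶∃¬; injective⇒≤; punchIn-injective; splitAt-↑ˡ; splitAt-↑ʳ)
open import Data.List as List using (List; []; _∷_; _∷ʳ_; _++_; [_]; length; map)
open import Data.List.Membership.DecPropositional using (_∈?_)
open import Data.List.Membership.Propositional using (_∈_)
open import Data.List.Membership.Propositional.Properties using (∈-lookup)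
open import Data.List.Properties using (length-map; length-++; map-++)
open import Data.List.Relation.Unary.All as All using (All; []; _∷_)
import Data.List.Relation.Unary.All.Properties as All
open import Data.List.Relation.Unary.AllPairs using (AllPairs; []; _∷_)
open import Data.List.Relation.Unary.Any using (here; there)
open import Data.List.Relation.Unary.Unique.Propositional using (Unique)
import Data.List.Relation.Unary.Unique.Propositional.Properties as Unique
open import Data.Nat using (ℕ; zero; suc; _+_; _≤_; _<_; _<ᵇ_; z≤n; s≤s)
open import Data.Nat.Properties as ℕ using (≤-refl; ≤-trans; <⇒≤; <⇒<ᵇ; <ᵇ⇒<; ≤-total)
open import Data.Product using (Σ; ∃; _×_; _,_; proj₁; proj₂)
open import Data.Sum using (_⊎_; inj₁; inj₂)
open import Data.Unit using (tt)
open import Data.Vec using (Vec; []; _∷_; lookup; removeAt; zipWith)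
open import Function using (_∘_; Equivalence)
open import Relation.Binary.Definitions using (tri<; tri≈; tri>)
open import Relation.Binary.PropositionalEquality hiding ([_])
open import Relation.Nullary using (¬_; Dec; yes; no)
open import Relation.Nullary.Decidable using (map′; _×-dec_)

private variable
  m N : ℕ

true≢false : {b : Bool} → b ≡ true → b ≡ false → ⊥
true≢false refl ()

-- Bilinear forms over F₂

_⊕_ : Vec Bool N → Vec Bool N → Vec Bool N
_⊕_ = zipWith _xor_

_·_ : Vec Bool N → Vec Bool N → Bool
[] · [] = false
(a ∷ u) · (b ∷ v) = (a ∧ b) xor (u · v)

·-sym : (u v : Vec Bool N) → u · v ≡ v · u
·-sym [] [] = refl
·-sym (a ∷ u) (b ∷ v) = cong₂ _xor_ (∧-comm a b) (·-sym u v)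

·-add : (u v w : Vec Bool N) → (u ⊕ v) · w ≡ (u · w) xor (v · w)
·-add [] [] [] = refl
·-add (a ∷ u) (b ∷ v) (c ∷ w)
  rewrite ·-add u v w | ∧-distribʳ-xor c a b = xor-interchange (a ∧ c) (b ∧ c) (u · w) (v · w)

-- The form is kept abstract because the induction replaces the dot product by projected forms while
-- the vectors stay fixed. Over F₂ additivity is all of linearity.
record Form (N : ℕ) : Set where
  field
    B   : Vec Bool N → Vec Bool N → Bool
    sym-B : ∀ u v → B u v ≡ B v u
    add : ∀ u v w → B (u ⊕ v) w ≡ B u w xor B v w

  addʳ : ∀ u v w → B u (v ⊕ w) ≡ B u v xor B u w
  addʳ u v w = trans (sym-B u (v ⊕ w)) (trans (add v w u) (cong₂ _xor_ (sym-B v u) (sym-B w u)))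

open Form

dot : ∀ N → Form N
dot N = record { B = _·_ ; sym-B = ·-sym ; add = ·-add }

-- Triangular systems and rank

data Triangular (F : Form N) : List (Vec Bool N × Vec Bool N) → Set where
  []   : Triangular F []
  cons : ∀ {d e ps} → B F d e ≡ true → All (λ p → B F d (proj₂ p) ≡ false) ps →
         Triangular F ps → Triangular F ((d , e) ∷ ps)

-- The rank of a bilinear form is the greatest length of a unitriangular system of pairs, so a bound
-- on these lengths avoids bases and quotients.
RankAtMost : Form N → ℕ → Set
RankAtMost F m = ∀ ps → Triangular F ps → length ps ≤ m

triangular-snoc : (F : Form N) → ∀ {ps d e} → Triangular F ps → B F d e ≡ true →
  All (λ p → B F (proj₁ p) e ≡ false) ps → Triangular F (ps ∷ʳ (d , e))
triangular-snoc F [] de _ = cons de [] []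
triangular-snoc F (cons x ⊥s t) de (h ∷ hs) =
  cons x (All.∷ʳ⁺ ⊥s h) (triangular-snoc F t de hs)

dot-nonzero : (u v : Vec Bool N) → u · v ≡ true → ∃ λ s → lookup u s ≡ true
dot-nonzero [] [] ()
dot-nonzero (true ∷ u) (b ∷ v) _ = 0F , refl
dot-nonzero (false ∷ u) (b ∷ v) eq with dot-nonzero u v eq
... | s , h = fsuc s , h

dot-removeAt : (u v : Vec Bool (suc N)) (s : Fin (suc N)) → lookup u s ≡ false →
  u · v ≡ removeAt u s · removeAt v s
dot-removeAt (false ∷ u) (b ∷ v) 0F refl = refl
dot-removeAt (a ∷ u@(_ ∷ _)) (b ∷ v@(_ ∷ _)) (fsuc s) h = cong ((a ∧ b) xor_) (dot-removeAt u v s h)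

lookup-⊕ : (u v : Vec Bool N) (s : Fin N) → lookup (u ⊕ v) s ≡ lookup u s xor lookup v s
lookup-⊕ (a ∷ u) (b ∷ v) 0F = refl
lookup-⊕ (a ∷ u) (b ∷ v) (fsuc s) = lookup-⊕ u v s

-- Gaussian elimination of the coordinate s, using a pivot vector c with c_s = 1.
module _ (c : Vec Bool (suc N)) (s : Fin (suc N)) (cs : lookup c s ≡ true) where

  reduce : Vec Bool (suc N) → Vec Bool (suc N)
  reduce d = if lookup d s then d ⊕ c else d

  reduce-lookup : ∀ d → lookup (reduce d) s ≡ false
  reduce-lookup d with lookup d s in eq
  ... | false = eq
  ... | true rewrite lookup-⊕ d c s | eq | cs = refl

  reduce-dot : ∀ d e → c · e ≡ false → reduce d · e ≡ d · e
  reduce-dot d e ce with lookup d s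
  ... | false = refl
  ... | true rewrite ·-add d c e | ce = xor-comm (d · e) false

  eliminate : Vec Bool (suc N) × Vec Bool (suc N) → Vec Bool N × Vec Bool N
  eliminate (d , e) = removeAt (reduce d) s , removeAt e s

  eliminate-dot : ∀ d e → c · e ≡ false → removeAt (reduce d) s · removeAt e s ≡ d · e
  eliminate-dot d e ce = trans (sym (dot-removeAt (reduce d) e s (reduce-lookup d))) (reduce-dot d e ce)

  eliminate-triangular : ∀ {ps} → All (λ p → c · proj₂ p ≡ false) ps →
    Triangular (dot (suc N)) ps → Triangular (dot N) (map eliminate ps)
  eliminate-triangular [] [] = []
  eliminate-triangular {(d , e) ∷ ps} (ce ∷ ces) (cons de ⊥s t) =
    cons (trans (eliminate-dot d e ce) de)
         (All.map⁺ (All.zipWith (λ { {_ , e'} (h , ce') → trans (eliminate-dot d e' ce') h }) (⊥s , ces)))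
         (eliminate-triangular ces t)

-- The first pair supplies a pivot: `d` has a coordinate equal to 1. Adding `d` to the later first
-- components that are 1 there clears the coordinate and keeps all products, since `d` is orthogonal
-- to the later second components. The coordinate can then be dropped.
dot-rank : ∀ N → RankAtMost (dot N) N
dot-rank N [] [] = z≤n
dot-rank zero (([] , []) ∷ ps) (cons () _ _)
dot-rank (suc N) ((d , e) ∷ ps) (cons de ⊥s t) with dot-nonzero d e de
... | s , ds = s≤s (subst (_≤ N) (length-map (eliminate d s ds) ps)
    (dot-rank N _ (eliminate-triangular d s ds ⊥s t)))

-- The form induced on the orthogonal complement of z when B z z = 1.
project : Form N → Vec Bool N → Form N
project F z = record
  { B = λ u v → B F u v xor (B F u z ∧ B F v z)
  ; sym-B = λ u v → cong₂ _xor_ (sym-B F u v) (∧-comm (B F u z) (B F v z))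
  ; add = λ u v w → trans
      (cong₂ _xor_ (add F u v w)
        (trans (cong (_∧ B F w z) (add F u v z)) (∧-distribʳ-xor (B F w z) (B F u z) (B F v z))))
      (xor-interchange (B F u w) (B F v w) _ _) }

module _ (F : Form N) (z : Vec Bool N) where

  project-⊥ˡ : ∀ {u v} → B F u z ≡ false → B (project F z) u v ≡ B F u v
  project-⊥ˡ {u} {v} h rewrite h = xor-comm (B F u v) false

  project-⊥ʳ : ∀ {u v} → B F v z ≡ false → B (project F z) u v ≡ B F u v
  project-⊥ʳ {u} {v} h = trans (sym-B (project F z) u v) (trans (project-⊥ˡ h) (sym-B F v u))

  module _ (zz : B F z z ≡ true) where

    correct : Vec Bool N → Vec Bool N
    correct e = if B F e z then e ⊕ z else e

    correct-⊥ : ∀ e → B F z (correct e) ≡ false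
    correct-⊥ e with B F e z in eq
    ... | false = trans (sym-B F z e) eq
    ... | true rewrite addʳ F z e z | sym-B F z e | eq | zz = refl

    correct-B : ∀ d e → B F d (correct e) ≡ B (project F z) d e
    correct-B d e with B F e z
    ... | false = trans (xor-comm false (B F d e)) (cong (B F d e xor_) (∧-comm false (B F d z)))
    ... | true rewrite addʳ F d e z = cong (B F d e xor_) (∧-comm true (B F d z))

    private
      fix : Vec Bool N × Vec Bool N → Vec Bool N × Vec Bool N
      fix (d , e) = d , correct e

      fix-triangular : ∀ {ps} → Triangular (project F z) ps → Triangular F (map fix ps)
      fix-triangular [] = []
      fix-triangular (cons {d} {e} de ⊥s t) =
        cons (trans (correct-B d e) de) (All.map⁺ (All.map (λ {p} h → trans (correct-B d (proj₂ p)) h) ⊥s))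
             (fix-triangular t)

    -- Correcting the second components makes them orthogonal to `z` and turns their products in `F`
    -- into those of the projected form. The pair `(z , z)` can then go in front of the lifted
    -- system, which uses up one unit of rank.
    project-rank : RankAtMost F (suc m) → RankAtMost (project F z) m
    project-rank rank ps t with rank ((z , z) ∷ map fix ps)
        (cons zz (All.map⁺ (All.universal (correct-⊥ ∘ proj₂) ps)) (fix-triangular t))
    ... | s≤s h = subst (_≤ _) (length-map fix ps) h

-- Vectors with positions, and cyclic triples

Point : ℕ → Set
Point N = Vec Bool N × ℕ

vec : Point N → Vec Bool N
vec = proj₁

pos : Point N → ℕ
pos = proj₂

_≺_ : Point N → Point N → Bool
u ≺ w = pos u <ᵇ pos w

<⇒<ᵇ-true : ∀ {a b} → a < b → (a <ᵇ b) ≡ true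
<⇒<ᵇ-true = Equivalence.to T-≡ ∘ <⇒<ᵇ

≥⇒<ᵇ-false : ∀ {a b} → b ≤ a → (a <ᵇ b) ≡ false
≥⇒<ᵇ-false {a} {b} b≤a = ¬-not λ h → ℕ.<⇒≱ (<ᵇ⇒< a b (Equivalence.from T-≡ h)) b≤a

<ᵇ-true⇒< : ∀ {a b} → (a <ᵇ b) ≡ true → a < b
<ᵇ-true⇒< {a} {b} h = <ᵇ⇒< a b (Equivalence.from T-≡ h)

<ᵇ-monoˡ : ∀ {a b} c → a < b → (a <ᵇ c) ≡ false → (b <ᵇ c) ≡ false
<ᵇ-monoˡ {a} c a<b h = ≥⇒<ᵇ-false {_} {c} (ℕ.≮⇒≥ λ b<c → true≢false (<⇒<ᵇ-true (ℕ.<-trans a<b b<c)) h)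

-- The half-open intervals from a to b and from b to c are disjoint, so if w lies in both or in
-- neither, it lies in neither.
balanced-interval : ∀ {a b c} w → a < b → b < c →
  (a <ᵇ w) xor (b <ᵇ w) ≡ (b <ᵇ w) xor (c <ᵇ w) → (b <ᵇ w) xor (c <ᵇ w) ≡ false
balanced-interval {a} {b} {c} w a<b b<c h with b <ᵇ w in bw
... | false = <ᵇ-monoˡ w b<c bw
... | true with a <ᵇ w in aw
...   | true = sym h
...   | false = ⊥-elim (true≢false bw (<ᵇ-monoˡ w a<b aw))

-- A 3-cycle of the tournament in which u precedes v exactly when (position of u < position of v) xor G u v,
-- listed by increasing position; the two equations cover both orientations.
record CyclicTriple {I : Set} (ρ : I → ℕ) (G : I → I → Bool) (p q r : I) : Set where
  constructor cyc
  field
    p<q   : ρ p < ρ q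
    q<r   : ρ q < ρ r
    pr≠qr : G p r xor G q r ≡ true
    qp≠rp : G q p xor G r p ≡ true

cyclicTriple-cong : ∀ {I ρ G G' p q r} → (∀ u v → G u v ≡ G' u v) →
  CyclicTriple {I} ρ G p q r → CyclicTriple ρ G' p q r
cyclicTriple-cong {p = p} {q} {r} eq (cyc a b c d) =
  cyc a b (trans (cong₂ _xor_ (sym (eq p r)) (sym (eq q r))) c)
          (trans (cong₂ _xor_ (sym (eq q p)) (sym (eq r p))) d)

gram : {I : Set} → Form N → (I → Point N) → I → I → Bool
gram F f i j = B F (vec (f i)) (vec (f j))

-- This is the betweenness property. It speaks of sums of two products because a single product also
-- depends on which block comes first in the join.
Apart : {I J : Set} → Form N → (I → Point N) → (J → Point N) → Set
Apart F f g = ∀ i i' j →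
  B F (vec (f i)) (vec (g j)) xor B F (vec (f i')) (vec (g j)) ≡ (f i ≺ g j) xor (f i' ≺ g j)

Triple : ℕ → Set
Triple N = Fin 3 → Point N

Cyclic : Form N → Triple N → Set
Cyclic F τ = CyclicTriple (pos ∘ τ) (gram F τ) 0F 1F 2F

MutuallyApart : {I J : Set} → Form N → (I → Point N) → (J → Point N) → Set
MutuallyApart F f g = Apart F f g × Apart F g f

-- The first triple has the higher minimum, so sorted lists run downwards and their head is the
-- triple to be projected away.
Before : Form N → Triple N → Triple N → Set
Before F τ σ = pos (σ 0F) ≤ pos (τ 0F) × MutuallyApart F τ σ

Sorted : Form N → List (Triple N) → Set
Sorted F = AllPairs (Before F)

diff : Triple N → Vec Bool N
diff τ = vec (τ 1F) ⊕ vec (τ 2F)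

pair : Triple N → Vec Bool N × Vec Bool N
pair τ = diff τ , vec (τ 0F)

-- Sorted triples as triangular systems

module _ (F : Form N) where

  diff-apart : ∀ {J : Set} (τ : Triple N) (g : J → Point N) → Apart F τ g → ∀ j →
    B F (diff τ) (vec (g j)) ≡ (τ 1F ≺ g j) xor (τ 2F ≺ g j)
  diff-apart τ g ap j = trans (add F _ _ _) (ap 1F 2F j)

  diff-min : ∀ {τ} → Cyclic F τ → B F (diff τ) (vec (τ 0F)) ≡ true
  diff-min c = trans (add F _ _ _) (CyclicTriple.qp≠rp c)

  module _ {τ σ : Triple N} (c : Cyclic F τ) (b : Before F τ σ) where
    open CyclicTriple c

    private
      σ≤p = proj₁ b
      σ≤q = ≤-trans σ≤p (<⇒≤ p<q)
      σ≤r = ≤-trans σ≤q (<⇒≤ q<r)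

    -- Both q and r of `τ` lie above the minimum of `σ`, which therefore does not separate them.
    diff-before : B F (diff τ) (vec (σ 0F)) ≡ false
    diff-before = trans (diff-apart τ σ (proj₁ (proj₂ b)) 0F)
      (cong₂ _xor_ (≥⇒<ᵇ-false σ≤q) (≥⇒<ᵇ-false σ≤r))

    first-diff-before : B F (vec (τ 0F) ⊕ vec (τ 1F)) (vec (σ 0F)) ≡ false
    first-diff-before = trans (trans (add F _ _ _) (proj₁ (proj₂ b) 0F 1F 0F))
      (cong₂ _xor_ (≥⇒<ᵇ-false σ≤p) (≥⇒<ᵇ-false σ≤q))

  sorted-triangular : ∀ {τs} → All (Cyclic F) τs → Sorted F τs → Triangular F (map pair τs)
  sorted-triangular [] [] = []
  sorted-triangular (c ∷ cs) (b ∷ bs) =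
    cons (diff-min c) (All.map⁺ (All.map (diff-before c) b)) (sorted-triangular cs bs)

  sorted-length : ∀ {τs} → RankAtMost F m → All (Cyclic F) τs → Sorted F τs → length τs ≤ m
  sorted-length {τs = τs} rank cs ss =
    subst (_≤ _) (length-map pair τs) (rank _ (sorted-triangular cs ss))

  -- The last component replaces a permutation: any property of `τ` and of the old list passes to
  -- the new one.
  insert : ∀ τ {τs} → All (MutuallyApart F τ) τs → Sorted F τs →
    ∃ λ τs' → Sorted F τs' × length τs' ≡ suc (length τs) ×
      (∀ {P : Triple N → Set} → P τ → All P τs → All P τs')
  insert τ [] [] = τ ∷ [] , [] ∷ [] , refl , λ p _ → p ∷ []
  insert τ {σ ∷ σs} (a ∷ as) (b ∷ bs) with ≤-total (pos (σ 0F)) (pos (τ 0F))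
  ... | inj₁ σ≤τ = τ ∷ σ ∷ σs
        , ((σ≤τ , a) ∷ All.zipWith (λ { ((le , _) , a') → ≤-trans le σ≤τ , a' }) (b , as)) ∷ b ∷ bs
        , refl , λ p ps → p ∷ ps
  ... | inj₂ τ≤σ with insert τ as bs
  ...   | σs' , ss , len , all = σ ∷ σs' , all (τ≤σ , proj₂ a , proj₁ a) b ∷ ss , cong suc len
        , λ { p (q ∷ ps) → q ∷ all p ps }

  -- With as many triples as the rank allows, a vector orthogonal to all the minima is in the
  -- radical. For the triple p < q < r with the highest minimum, x_p + x_r is such a vector, so no vertex
  -- of another block lies between p and r, whence x_q + x_r is orthogonal to all of them.
  module Extremal (τ : Triple N) (τs : List (Triple N)) (rank : RankAtMost F (suc (length τs)))
    (c : Cyclic F τ) (cs : All (Cyclic F) τs) (bs : All (Before F τ) τs) (ss : Sorted F τs) where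
    open CyclicTriple c

    private
      system : Triangular F (map pair (τ ∷ τs))
      system = sorted-triangular (c ∷ cs) (bs ∷ ss)

      d₁ d₂ : Vec Bool N
      d₁ = vec (τ 0F) ⊕ vec (τ 1F)
      d₂ = diff τ

      overfull : ¬ suc (length (map pair (τ ∷ τs))) ≤ suc (length τs)
      overfull h = ℕ.1+n≰n (subst (λ k → suc k ≤ suc (length τs)) (length-map pair (τ ∷ τs)) h)

      radical : ∀ v → All (λ p → B F v (proj₂ p) ≡ false) (map pair (τ ∷ τs)) → ∀ f → B F v f ≡ false
      radical v ⊥s f = ¬-not λ vf → overfull (rank _ (cons vf ⊥s system))

      d₁-max : B F d₁ (vec (τ 2F)) ≡ true
      d₁-max = trans (add F _ _ _) pr≠qr

      -- Otherwise x_p + x_q would be orthogonal to all minima and hence in the radical, against its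
      -- product 1 with x_r.
      d₁-min : B F d₁ (vec (τ 0F)) ≡ true
      d₁-min with B F d₁ (vec (τ 0F)) in eq
      ... | true = refl
      ... | false = ⊥-elim (true≢false d₁-max (radical d₁
              (eq ∷ All.map⁺ (All.zipWith (λ { (b , _) → first-diff-before c b }) (bs , cs))) _))

      d₁⊕d₂-radical : ∀ f → B F (d₁ ⊕ d₂) f ≡ false
      d₁⊕d₂-radical = radical (d₁ ⊕ d₂)
        ( trans (add F _ _ _) (cong₂ _xor_ d₁-min (diff-min c))
        ∷ All.map⁺ (All.map (λ b → trans (add F _ _ _)
            (cong₂ _xor_ (first-diff-before c b) (diff-before c b))) bs))

      xor-false⇒≡ : ∀ a b → a xor b ≡ false → a ≡ b
      xor-false⇒≡ false b h = sym h
      xor-false⇒≡ true true h = refl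

      d₁≡d₂ : ∀ f → B F d₁ f ≡ B F d₂ f
      d₁≡d₂ f = xor-false⇒≡ _ _ (trans (sym (add F d₁ d₂ f)) (d₁⊕d₂-radical f))

    orthogonal : ∀ {J : Set} (g : J → Point N) → Apart F τ g → ∀ j → B F (diff τ) (vec (g j)) ≡ false
    -- `d₁` detects whether a vertex lies between p and q, `d₂` whether it lies between q and r.
    -- Their products agree, so it lies in neither interval.
    orthogonal g ap j = trans (diff-apart τ g ap j) (balanced-interval (pos (g j)) p<q q<r
      (trans (sym (ap 0F 1F j)) (trans (sym (add F _ _ _)) (trans (d₁≡d₂ _) (diff-apart τ g ap j)))))

    -- If `d₂` were orthogonal to itself, the pair of x_p and `d₂` could be appended to the system,
    -- making it longer than the rank: every other difference is orthogonal to `d₂`.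
    unit : B F (diff τ) (diff τ) ≡ true
    unit with B F d₂ d₂ in eq
    ... | true = refl
    ... | false = ⊥-elim (overfull (subst (_≤ suc (length τs))
          (trans (length-++ (map pair (τ ∷ τs))) (ℕ.+-comm _ 1)) (rank _
          (triangular-snoc F system (trans (sym-B F (vec (τ 0F)) d₂) (diff-min c))
            (eq ∷ All.map⁺ (All.map (λ {σ} b → diffs-⊥ σ b) bs))))))
      where
      diffs-⊥ : ∀ σ → Before F τ σ → B F (diff σ) d₂ ≡ false
      diffs-⊥ σ b = trans (add F _ _ _) (cong₂ _xor_
        (trans (sym-B F _ _) (orthogonal σ (proj₁ (proj₂ b)) 1F))
        (trans (sym-B F _ _) (orthogonal σ (proj₁ (proj₂ b)) 2F)))

-- Passing to the orthogonal complement of a vector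

Orthogonal : {I : Set} → Form N → Vec Bool N → (I → Point N) → Set
Orthogonal F z f = ∀ i → B F (vec (f i)) z ≡ false

module _ (F : Form N) (z : Vec Bool N) where

  project-gram : ∀ {I} (f : I → Point N) → Orthogonal F z f → ∀ i j → gram F f i j ≡ gram (project F z) f i j
  project-gram f ⊥f i j = sym (project-⊥ˡ F z (⊥f i))

  project-apartʳ : ∀ {I J} (f : I → Point N) (g : J → Point N) → Orthogonal F z g →
    Apart F f g → Apart (project F z) f g
  project-apartʳ f g ⊥g ap i i' j =
    trans (cong₂ _xor_ (project-⊥ʳ F z (⊥g j)) (project-⊥ʳ F z (⊥g j))) (ap i i' j)

  project-apartˡ : ∀ {I J} (f : I → Point N) (g : J → Point N) → Orthogonal F z f →
    Apart F f g → Apart (project F z) f g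
  project-apartˡ f g ⊥f ap i i' j =
    trans (cong₂ _xor_ (project-⊥ˡ F z (⊥f i)) (project-⊥ˡ F z (⊥f i'))) (ap i i' j)

  -- One orthogonal side is enough, since the correction term is a product with a factor from each
  -- side. This allows `z` to come from the block `f` itself.
  project-mutual : ∀ {I J} (f : I → Point N) (g : J → Point N) → Orthogonal F z g →
    MutuallyApart F f g → MutuallyApart (project F z) f g
  project-mutual f g ⊥g (fg , gf) = project-apartʳ f g ⊥g fg , project-apartˡ g f ⊥g gf

  project-cyclic : ∀ {τs} → All (Orthogonal F z) τs → All (Cyclic F) τs → All (Cyclic (project F z)) τs
  project-cyclic ⊥s cs = All.zipWith (λ { {τ} (⊥τ , c) → cyclicTriple-cong (project-gram τ ⊥τ) c }) (⊥s , cs)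

  project-sorted : ∀ {τs} → All (Orthogonal F z) τs → Sorted F τs → Sorted (project F z) τs
  project-sorted [] [] = []
  project-sorted (_∷_ {τ} _ ⊥s) (b ∷ bs) =
    All.zipWith (λ { {σ} (⊥σ , le , ap) → le , project-mutual τ σ ⊥σ ap }) (⊥s , b) ∷ project-sorted ⊥s bs

-- No single set decycles the block; α = 0 gives that it is not acyclic to begin with.
TwiceCyclic : {I : Set} → (I → ℕ) → (I → I → Bool) → Set
TwiceCyclic {I} ρ G = (α : I → Bool) →
  ∃ λ p → ∃ λ q → ∃ λ r → CyclicTriple ρ (λ u v → (α u ∧ α v) xor G u v) p q r

triple : {I : Set} → (I → Point N) → I → I → I → Triple N
triple f p q r = f ∘ lookup (p ∷ q ∷ r ∷ [])

triple-cyclic : ∀ {I p q r} (F : Form N) (f : I → Point N) →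
  CyclicTriple (pos ∘ f) (gram F f) p q r → Cyclic F (triple f p q r)
triple-cyclic F f (cyc a b c d) = cyc a b c d

triple-apart : ∀ {I J} (F : Form N) p q r (f : I → Point N) (g : J → Point N) →
  MutuallyApart F f g → MutuallyApart F (triple f p q r) g
triple-apart F p q r f g (fg , gf) =
  (λ i i' j → fg _ _ j) , (λ i i' j → gf i i' _)

-- The block that no single inversion makes acyclic

module _ {I : Set} (f : I → Point N) (G : I → I → Bool) (twice : TwiceCyclic (pos ∘ f) G) where

  -- If the triple taken from f has the highest minimum, then projecting away its vector z amounts to
  -- inverting α = ⟨-, z⟩ in f, after which f still supplies a triple: one too many for the lower rank.
  highest-impossible : (F : Form N) (τs : List (Triple N)) → RankAtMost F (suc (length τs)) →
    (∀ i j → G i j ≡ gram F f i j) → All (Cyclic F) τs → Sorted F τs → All (MutuallyApart F f) τs →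
    ∀ p q r → Cyclic F (triple f p q r) → All (λ σ → pos (σ 0F) ≤ pos (f p)) τs → ⊥
  highest-impossible F τs rank G≡ cs ss fs p q r c le
    with p' , q' , r' , c' ← twice (λ i → B F (vec (f i)) (diff (triple f p q r))) =
    ℕ.1+n≰n (subst (_≤ length τs) σs-length
      (sorted-length F' (project-rank F z unit rank)
        (all (triple-cyclic F' f (cyclicTriple-cong (λ u v → trans (xor-comm (B F (vec (f u)) z ∧ B F (vec (f v)) z) (G u v)) (cong (_xor (B F (vec (f u)) z ∧ B F (vec (f v)) z)) (G≡ u v))) c')) (project-cyclic F z ⊥s cs))
        σs-sorted))
    where
    z = diff (triple f p q r)
    F' = project F z
    aparts : All (MutuallyApart F (triple f p q r)) τs
    aparts = All.map (λ {σ} → triple-apart F p q r f σ) fs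
    open Extremal F (triple f p q r) τs rank c cs (All.zip (le , aparts)) ss
    ⊥s : All (Orthogonal F z) τs
    ⊥s = All.map (λ {σ} a i → trans (sym-B F (vec (σ i)) z) (orthogonal σ (proj₁ a) i)) aparts
    inserted = insert F' (triple f p' q' r')
      (All.zipWith (λ { {σ} (⊥σ , a) → triple-apart F' p' q' r' f σ (project-mutual F z f σ ⊥σ a) }) (⊥s , fs))
      (project-sorted F z ⊥s ss)
    σs-sorted = proj₁ (proj₂ inserted)
    σs-length = proj₁ (proj₂ (proj₂ inserted))
    all = proj₂ (proj₂ (proj₂ inserted))

  -- Induction on the other triples. If the head `τ` lies above the triple from `f`, its vector `z`
  -- is orthogonal to `f` and to the remaining triples, so projecting changes none of their products
  -- and lowers the rank by one.
  twiceCyclic-rank : (F : Form N) (τs : List (Triple N)) → RankAtMost F (suc (length τs)) →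
    (∀ i j → G i j ≡ gram F f i j) → All (Cyclic F) τs → Sorted F τs → All (MutuallyApart F f) τs → ⊥
  twiceCyclic-rank F τs rank G≡ cs ss fs
    with p , q , r , c ← twice (λ _ → false)
    with ρ-cyclic ← triple-cyclic F f (cyclicTriple-cong G≡ c)
    with τs | cs | ss | fs
  ... | [] | _ | _ | _ = highest-impossible F [] rank G≡ [] [] [] p q r ρ-cyclic []
  ... | τ ∷ τs | c ∷ cs | b ∷ bs | a ∷ as with ≤-total (pos (τ 0F)) (pos (f p))
  ...   | inj₁ τ≤ρ = highest-impossible F (τ ∷ τs) rank G≡ (c ∷ cs) (b ∷ bs) (a ∷ as) p q r ρ-cyclic
                       (τ≤ρ ∷ All.map (λ { (le , _) → ≤-trans le τ≤ρ }) b)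
  ...   | inj₂ ρ≤τ = twiceCyclic-rank F' τs (project-rank F z unit rank)
                       (λ i j → trans (G≡ i j) (project-gram F z f f⊥ i j))
                       (project-cyclic F z ⊥s cs) (project-sorted F z ⊥s bs)
                       (All.zipWith (λ { {σ} (⊥σ , a') → project-mutual F z f σ ⊥σ a' }) (⊥s , as))
    where
    z = diff τ
    F' = project F z
    ρ-τ = triple-apart F p q r f τ a
    inserted = insert F (triple f p q r) (All.map (λ {σ} → triple-apart F p q r f σ) as) bs
    σs = proj₁ inserted
    all = proj₂ (proj₂ (proj₂ inserted))
    -- The triple from `f` is counted in `σs`, so `τ` and `σs` together are as many triples as the
    -- rank allows.
    open Extremal F τ σs (subst (RankAtMost F ∘ suc) (sym (proj₁ (proj₂ (proj₂ inserted)))) rank)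
      c (all ρ-cyclic cs) (all (ρ≤τ , proj₂ ρ-τ , proj₁ ρ-τ) b) (proj₁ (proj₂ inserted))
    ⊥s : All (Orthogonal F z) τs
    ⊥s = All.map (λ {σ} b' i → trans (sym-B F (vec (σ i)) z) (orthogonal σ (proj₁ (proj₂ b')) i)) b
    f⊥ : Orthogonal F z f
    f⊥ i = trans (sym-B F (vec (f i)) z) (orthogonal f (proj₂ a) i)

-- Topological orders

module _ {n : ℕ} {E : Fin n → Fin n → Bool} {R : Fin n → Fin n → Set}
  (R-irrefl : ∀ {u} → ¬ R u u) (R-trans : ∀ {u v w} → R u v → R v w → R u w)
  (E⇒R : ∀ u v → E u v ≡ true → R u v) where

  acyclic-of-order : Acyclic (record { n = n ; E = E })
  acyclic-of-order (v ∷ vs) (_ , path) = R-irrefl (go v vs path)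
    where
    go : ∀ u us → Consecutive E ((u ∷ us) ++ [ v ]) → R u v
    go u [] (e , _) = E⇒R u v (Equivalence.to T-≡ e)
    go u (w ∷ us) (e , es) = R-trans (E⇒R u w (Equivalence.to T-≡ e)) (go w us es)

consecutive-map : ∀ {m n} {e : Fin m → Fin m → Bool} {e' : Fin n → Fin n → Bool} (f : Fin m → Fin n) →
  (∀ u v → T (e u v) → T (e' (f u) (f v))) → ∀ xs → Consecutive e xs → Consecutive e' (map f xs)
consecutive-map f h [] _ = tt
consecutive-map f h (x ∷ []) _ = tt
consecutive-map f h (x ∷ y ∷ xs) (e , es) = h x y e , consecutive-map f h (y ∷ xs) es

acyclic-embed : ∀ {D D' : Digraph} (f : Fin (n D) → Fin (n D')) → (∀ {u v} → f u ≡ f v → u ≡ v) →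
  (∀ u v → T (E D u v) → T (E D' (f u) (f v))) → Acyclic D' → Acyclic D
acyclic-embed {D} {D'} f inj h ac (v ∷ vs) (u , c) = ac (map f (v ∷ vs))
  ( Unique.map⁺ inj u
  , subst (Consecutive (E D')) (map-++ f (v ∷ vs) [ v ]) (consecutive-map f h ((v ∷ vs) ++ [ v ]) c))

-- Edge functions are compared pointwise, which stands in for function extensionality.
acyclic-cong : ∀ {n} {e e' : Fin n → Fin n → Bool} → (∀ u v → e u v ≡ e' u v) →
  Acyclic (record { n = n ; E = e }) → Acyclic (record { n = n ; E = e' })
acyclic-cong eq = acyclic-embed (λ v → v) (λ h → h) (λ u v → subst T (sym (eq u v)))

unique-lookup-injective : ∀ {A : Set} {xs : List A} → Unique xs →
  ∀ {i j} → List.lookup xs i ≡ List.lookup xs j → i ≡ j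
unique-lookup-injective (_ ∷ _) {0F} {0F} _ = refl
unique-lookup-injective (x∉ ∷ _) {0F} {fsuc j} h = ⊥-elim (All.lookup x∉ (∈-lookup j) h)
unique-lookup-injective (x∉ ∷ _) {fsuc i} {0F} h = ⊥-elim (All.lookup x∉ (∈-lookup i) (sym h))
unique-lookup-injective (_ ∷ u) {fsuc i} {fsuc j} h = cong fsuc (unique-lookup-injective u h)

module _ (D : Digraph) (pred : ∀ v → ∃ λ u → E D u v ≡ true) where

  private
    -- Cuts a path at `y`. The last component hands the freshness of a vertex down to the part that
    -- is kept.
    close : ∀ {y} w xs → Consecutive (E D) (w ∷ xs) → Unique xs → y ∈ xs →
      ∃ λ ys → Consecutive (E D) (w ∷ ys ++ [ y ]) × Unique (y ∷ ys) ×
        (∀ {P : Fin (n D) → Set} → All P xs → All P ys)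
    close w (x ∷ xs) (e , es) (x∉ ∷ u) (here refl) = [] , (e , tt) , [] ∷ [] , λ _ → []
    close w (x ∷ xs) (e , es) (x∉ ∷ u) (there y∈xs) with close x xs es u y∈xs
    ... | ys , c , y∉ ∷ v , all =
      x ∷ ys , (e , c) , ((λ y≡x → All.lookup x∉ y∈xs (sym y≡x)) ∷ y∉) ∷ all x∉ ∷ v , λ { (p ∷ ps) → p ∷ all ps }

    -- Walks backwards along predecessors until a vertex repeats. A path without repetition has at
    -- most as many vertices as the digraph, so the fuel cannot run out.
    walk : ∀ fuel x xs → Unique (x ∷ xs) → Consecutive (E D) (x ∷ xs) →
      n D < fuel + length (x ∷ xs) → ∃ (IsCycle D)
    walk zero x xs u c n< = ⊥-elim (ℕ.<⇒≱ n< (injective⇒≤ (unique-lookup-injective u)))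
    walk (suc fuel) x xs u c n< with pred x
    ... | y , yx with _∈?_ _≟_ y (x ∷ xs)
    ...   | no y∉ = walk fuel y (x ∷ xs) (All.¬Any⇒All¬ _ y∉ ∷ u) (Equivalence.from T-≡ yx , c)
                     (subst (n D <_) (sym (ℕ.+-suc fuel _)) n<)
    ...   | yes y∈ with close y (x ∷ xs) (Equivalence.from T-≡ yx , c) u y∈
    ...     | ys , c' , u' , _ = y ∷ ys , u' , c'

  cycle-of-predecessors : Fin (n D) → ∃ (IsCycle D)
  cycle-of-predecessors v = walk (n D) v [] ([] ∷ []) tt (subst (n D <_) (ℕ.+-comm 1 (n D)) ≤-refl)

source : ∀ {n} (e : Fin (suc n) → Fin (suc n) → Bool) → Acyclic (record { n = suc n ; E = e }) →
  ∃ λ s → ∀ u → e u s ≡ false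
source {n} e ac with all? (λ v → any? (λ u → e u v ≟ᵇ true))
... | yes pred = ⊥-elim (let (cs , cycle) = cycle-of-predecessors _ pred 0F in ac cs cycle)
... | no ¬pred with ¬∀⟶∃¬ (suc n) _ (λ v → any? (λ u → e u v ≟ᵇ true)) ¬pred
...   | s , h = s , λ u → ¬-not λ us → h (u , us)

-- Ranks are injective but may have gaps, so a ranking of the join restricts to each block.
Ranking : ∀ {n} → (Fin n → Fin n → Bool) → (Fin n → ℕ) → Set
Ranking e ρ = (∀ u v → ρ u ≡ ρ v → u ≡ v) × (∀ u v → e u v ≡ true → ρ u < ρ v)

topological-ranking : ∀ n (e : Fin n → Fin n → Bool) → Acyclic (record { n = n ; E = e }) → ∃ (Ranking e)
topological-ranking zero e ac = (λ ()) , (λ ()) , (λ ())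
topological-ranking (suc n) e ac with source e ac
... | s , no-pred with topological-ranking n (λ u v → e (punchIn s u) (punchIn s v))
                        (acyclic-embed (punchIn s) (punchIn-injective s _ _) (λ _ _ h → h) ac)
...   | ρ , ρ-inj , ρ-mono = rank , rank-inj , rank-mono
  where
  rank : Fin (suc n) → ℕ
  rank u with s ≟ u
  ... | yes _ = 0
  ... | no s≢u = suc (ρ (punchOut s≢u))
  rank-inj : ∀ u v → rank u ≡ rank v → u ≡ v
  rank-inj u v h with s ≟ u | s ≟ v
  ... | yes p | yes q = trans (sym p) q
  ... | no s≢u | no s≢v = Fin.punchOut-injective s≢u s≢v (ρ-inj _ _ (ℕ.suc-injective h))
  rank-mono : ∀ u v → e u v ≡ true → rank u < rank v
  rank-mono u v uv with s ≟ u | s ≟ v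
  ... | _ | yes refl = ⊥-elim (true≢false uv (no-pred u))
  ... | yes _ | no _ = s≤s z≤n
  ... | no s≢u | no s≢v = s≤s (ρ-mono _ _
          (trans (cong₂ e (Fin.punchIn-punchOut s≢u) (Fin.punchIn-punchOut s≢v)) uv))

-- Inversion families as vectors

signature : ∀ {A : Set} (Xs : List (A → Bool)) → A → Vec Bool (length Xs)
signature [] v = []
signature (X ∷ Xs) v = X v ∷ signature Xs v

parity : ∀ {A : Set} → List (A → Bool) → A → A → Bool
parity Xs u v = signature Xs u · signature Xs v

reverseIf : ∀ {n} → (Fin n → Fin n → Bool) → (Fin n → Fin n → Bool) → Fin n → Fin n → Bool
reverseIf g e u v = if g u v then e v u else e u v

-- Two reversals of a pair cancel, so successive inversions add up modulo 2 and only the parity of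
-- the sets containing both ends matters.
reverseIf-invert : ∀ {n} (e G : Fin n → Fin n → Bool) (X : Fin n → Bool) u v →
  reverseIf G (λ a b → if X a ∧ X b then e b a else e a b) u v ≡
  reverseIf (λ a b → (X a ∧ X b) xor G a b) e u v
reverseIf-invert e G X u v with X u | X v | G u v
... | false | false | false = refl
... | false | false | true = refl
... | false | true | false = refl
... | false | true | true = refl
... | true | false | false = refl
... | true | false | true = refl
... | true | true | false = refl
... | true | true | true = refl

decycling⇒acyclic : ∀ D Xs → Decycling D Xs → Acyclic (record { n = n D ; E = reverseIf (parity Xs) (E D) })
decycling⇒acyclic D [] ac = ac
decycling⇒acyclic D (X ∷ Xs) ac =
  acyclic-cong (reverseIf-invert (E D) (parity Xs) X) (decycling⇒acyclic (invert D X) Xs ac)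

acyclic⇒decycling : ∀ D Xs → Acyclic (record { n = n D ; E = reverseIf (parity Xs) (E D) }) → Decycling D Xs
acyclic⇒decycling D [] ac = ac
acyclic⇒decycling D (X ∷ Xs) ac =
  acyclic⇒decycling (invert D X) Xs (acyclic-cong (λ u v → sym (reverseIf-invert (E D) (parity Xs) X u v)) ac)

-- Cyclic triples from a digraph that is not acyclic

module Reversed {n : ℕ} (e G : Fin n → Fin n → Bool) (G-sym : ∀ u v → G u v ≡ G v u)
  (ρ : Fin n → ℕ) (ranking : Ranking (reverseIf G e) ρ) where

  -- An edge is reversed exactly when `ρ` puts its head before its tail. This version compares from
  -- the head and the next one from the tail, to serve both orders of two blocks in the join.
  edge-sourceward : ∀ u v → e u v ≡ true → G v u ≡ (ρ v <ᵇ ρ u)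
  edge-sourceward u v uv with G v u in vu
  ... | true = sym (<⇒<ᵇ-true (proj₂ ranking v u
                 (trans (cong (if_then e u v else e v u) vu) uv)))
  ... | false = sym (≥⇒<ᵇ-false (<⇒≤ (proj₂ ranking u v
                 (trans (cong (if_then e v u else e u v) (trans (G-sym u v) vu)) uv))))

  edge-targetward : ∀ u v → e u v ≡ true → G u v ≡ not (ρ u <ᵇ ρ v)
  edge-targetward u v uv with G u v in g
  ... | false = cong not (sym (<⇒<ᵇ-true (proj₂ ranking u v
                 (trans (cong (if_then e v u else e u v) g) uv))))
  ... | true = cong not (sym (≥⇒<ᵇ-false (<⇒≤ (proj₂ ranking v u
                 (trans (cong (if_then e u v else e v u) (trans (G-sym v u) g)) uv)))))

  -- The tournament completing e: the non-edges are oriented so that the reversal along G stays ranked by ρ.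
  toward : Fin n → Fin n → Bool
  toward u v = (ρ u <ᵇ ρ v) xor G u v

  private
    toward-up : ∀ {u v} → ρ u < ρ v → toward u v ≡ true → G u v ≡ false
    toward-up {u} {v} u<v h rewrite <⇒<ᵇ-true u<v with G u v
    ... | false = refl

    toward-down : ∀ {u v} → ρ v < ρ u → toward u v ≡ true → G u v ≡ true
    toward-down {u} {v} v<u h rewrite ≥⇒<ᵇ-false {ρ u} (<⇒≤ v<u) = h

    toward-total : ∀ {u v} → u ≢ v → toward u v ≡ false → toward v u ≡ true
    toward-total {u} {v} u≢v h with ℕ.<-cmp (ρ u) (ρ v)
    ... | tri≈ _ eq _ = ⊥-elim (u≢v (proj₁ ranking u v eq))
    ... | tri< u<v _ _ rewrite <⇒<ᵇ-true u<v | ≥⇒<ᵇ-false {ρ v} (<⇒≤ u<v) | G-sym v u with G u v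
    ...   | true = refl
    toward-total {u} {v} u≢v h | tri> _ _ v<u rewrite <⇒<ᵇ-true v<u | ≥⇒<ᵇ-false {ρ u} (<⇒≤ v<u) | G-sym v u | h = refl

    toward-asym : ∀ {u v} → u ≢ v → toward u v ≡ true → toward v u ≡ true → ⊥
    toward-asym {u} {v} u≢v uv vu with ℕ.<-cmp (ρ u) (ρ v)
    ... | tri≈ _ eq _ = u≢v (proj₁ ranking u v eq)
    ... | tri< u<v _ _ = true≢false (trans (G-sym u v) (toward-down u<v vu)) (toward-up u<v uv)
    ... | tri> _ _ v<u = true≢false (trans (G-sym v u) (toward-down v<u uv)) (toward-up v<u vu)

    CyclicTripleExists : Set
    CyclicTripleExists = ∃ λ p → ∃ λ q → ∃ λ r → CyclicTriple ρ G p q r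

    -- With the lowest vertex first, only the order of the other two is open. Either way the values
    -- of `G` read off the three arcs satisfy both equations.
    triangle-from-min : ∀ {u v w} → v ≢ w → ρ u < ρ v → ρ u < ρ w →
      toward u v ≡ true → toward v w ≡ true → toward w u ≡ true → CyclicTripleExists
    triangle-from-min {u} {v} {w} v≢w u<v u<w uv vw wu with ℕ.<-cmp (ρ v) (ρ w)
    ... | tri≈ _ eq _ = ⊥-elim (v≢w (proj₁ ranking v w eq))
    ... | tri< v<w _ _ = u , v , w , cyc u<v v<w
          (cong₂ _xor_ (trans (G-sym u w) (toward-down u<w wu)) (toward-up v<w vw))
          (cong₂ _xor_ (trans (G-sym v u) (toward-up u<v uv)) (toward-down u<w wu))
    ... | tri> _ _ w<v = u , w , v , cyc u<w w<v
          (cong₂ _xor_ (toward-up u<v uv) (trans (G-sym w v) (toward-down w<v vw)))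
          (cong₂ _xor_ (toward-down u<w wu) (trans (G-sym v u) (toward-up u<v uv)))

    triangle : ∀ {u v w} → u ≢ v → v ≢ w → u ≢ w →
      toward u v ≡ true → toward v w ≡ true → toward w u ≡ true → CyclicTripleExists
    triangle {u} {v} {w} u≢v v≢w u≢w uv vw wu
      with ℕ.<-cmp (ρ u) (ρ v) | ℕ.<-cmp (ρ v) (ρ w) | ℕ.<-cmp (ρ u) (ρ w)
    ... | tri≈ _ eq _ | _ | _ = ⊥-elim (u≢v (proj₁ ranking u v eq))
    ... | _ | tri≈ _ eq _ | _ = ⊥-elim (v≢w (proj₁ ranking v w eq))
    ... | _ | _ | tri≈ _ eq _ = ⊥-elim (u≢w (proj₁ ranking u w eq))
    ... | tri< u<v _ _ | _ | tri< u<w _ _ = triangle-from-min v≢w u<v u<w uv vw wu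
    ... | tri> _ _ v<u | tri< v<w _ _ | _ = triangle-from-min (u≢w ∘ sym) v<w v<u vw wu uv
    ... | _ | tri> _ _ w<v | tri> _ _ w<u = triangle-from-min u≢v w<u w<v wu uv vw
    ... | tri< u<v _ _ | tri< v<w _ _ | tri> _ _ w<u = ⊥-elim (ℕ.<-asym w<u (ℕ.<-trans u<v v<w))
    ... | tri> _ _ v<u | tri> _ _ w<v | tri< u<w _ _ = ⊥-elim (ℕ.<-asym u<w (ℕ.<-trans w<v v<u))

    cyclicTriple? : ∀ p q r → Dec (CyclicTriple ρ G p q r)
    cyclicTriple? p q r = map′ (λ { (a , b , c , d) → cyc a b c d }) (λ { (cyc a b c d) → a , b , c , d })
      (ρ p ℕ.<? ρ q ×-dec ρ q ℕ.<? ρ r ×-dec (G p r xor G q r) ≟ᵇ true ×-dec (G q p xor G r p) ≟ᵇ true)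

  -- A tournament without 3-cycles is transitive. If the finite search fails, `toward` is thus a
  -- strict order containing every edge of `e`, which makes `e` acyclic.
  cyclicTriple-exists : ¬ Acyclic (record { n = n ; E = e }) → CyclicTripleExists
  cyclicTriple-exists cyclic with any? (λ p → any? (λ q → any? (cyclicTriple? p q)))
  ... | yes t = t
  ... | no none = ⊥-elim (cyclic (acyclic-of-order (λ h → proj₁ h refl) R-trans e⇒R))
    where
    R : Fin n → Fin n → Set
    R u v = u ≢ v × toward u v ≡ true
    R-trans : ∀ {u v w} → R u v → R v w → R u w
    R-trans {u} {v} {w} (u≢v , uv) (v≢w , vw) = u≢w , towards
      where
      u≢w : u ≢ w
      u≢w refl = toward-asym u≢v uv vw
      towards : toward u w ≡ true
      towards with toward u w in eq
      ... | true = refl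
      ... | false = ⊥-elim (none (triangle u≢v v≢w u≢w uv vw (toward-total u≢w eq)))
    e⇒R : ∀ u v → e u v ≡ true → R u v
    e⇒R u v uv = (λ { refl → no-loop uv }) , trans (cong ((ρ u <ᵇ ρ v) xor_) (edge-targetward u v uv)) (xor-not (ρ u <ᵇ ρ v))
      where
      no-loop : ∀ {u} → e u u ≡ true → ⊥
      -- At a loop the two descriptions of `G u u` negate each other.
      no-loop {u} uu with trans (sym (edge-targetward u u uu)) (edge-sourceward u u uu)
      ... | h with ρ u <ᵇ ρ u
      no-loop uu | () | true
      no-loop uu | () | false
      xor-not : ∀ b → b xor not b ≡ true
      xor-not false = refl
      xor-not true = refl

-- Vertices of the join

encode : (k : ℕ) (f : Fin k → ℕ) (i : Fin k) → Fin (f i) → Fin (sumF k f)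
encode (suc k) f 0F a = a ↑ˡ _
encode (suc k) f (fsuc i) a = f 0F ↑ʳ encode k (f ∘ fsuc) i a

decode-encode : ∀ k f i a → decode k f (encode k f i a) ≡ (i , a)
decode-encode (suc k) f 0F a rewrite splitAt-↑ˡ (f 0F) a (sumF k (f ∘ fsuc)) = refl
decode-encode (suc k) f (fsuc i) a
  rewrite splitAt-↑ʳ (f 0F) (sumF k (f ∘ fsuc)) (encode k (f ∘ fsuc) i a)
        | decode-encode k (f ∘ fsuc) i a = refl

joinEdge-same : ∀ k Ds i a b → joinEdge k Ds (i , a) (i , b) ≡ E (Ds i) a b
joinEdge-same k Ds i a b with i ≟ i
... | yes refl = refl
... | no i≢i = ⊥-elim (i≢i refl)

joinEdge-distinct : ∀ k Ds {i j} a b → i ≢ j → joinEdge k Ds (i , a) (j , b) ≡ (toℕ i <ᵇ toℕ j)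
joinEdge-distinct k Ds {i} {j} a b i≢j with i ≟ j
... | yes i≡j = ⊥-elim (i≢j i≡j)
... | no _ = refl

-- Upper bound: the union of families of the blocks

parity-++ : ∀ {A : Set} (Xs Ys : List (A → Bool)) u v → parity (Xs ++ Ys) u v ≡ parity Xs u v xor parity Ys u v
parity-++ [] Ys u v = refl
parity-++ (X ∷ Xs) Ys u v = trans (cong ((X u ∧ X v) xor_) (parity-++ Xs Ys u v)) (sym (xor-assoc (X u ∧ X v) _ _))

parity-map : ∀ {A A' : Set} (h : (A → Bool) → A' → Bool) {a b} x y → (∀ X → h X x ≡ X a) → (∀ X → h X y ≡ X b) →
  ∀ Xs → parity (map h Xs) x y ≡ parity Xs a b
parity-map h x y hx hy [] = refl
parity-map h x y hx hy (X ∷ Xs) = cong₂ _xor_ (cong₂ _∧_ (hx X) (hy X)) (parity-map h x y hx hy Xs)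

parity-map-disjoint : ∀ {A A' : Set} (h : (A → Bool) → A' → Bool) x y → (∀ X → h X x ∧ h X y ≡ false) →
  ∀ Xs → parity (map h Xs) x y ≡ false
parity-map-disjoint h x y hxy [] = refl
parity-map-disjoint h x y hxy (X ∷ Xs) = cong₂ _xor_ (hxy X) (parity-map-disjoint h x y hxy Xs)

module Glue {k : ℕ} (f : Fin (suc k) → ℕ) where

  inFirst : (Fin (f 0F) → Bool) → Σ (Fin (suc k)) (Fin ∘ f) → Bool
  inFirst X (0F , a) = X a
  inFirst X (fsuc i , a) = false

  inRest : (Σ (Fin k) (Fin ∘ f ∘ fsuc) → Bool) → Σ (Fin (suc k)) (Fin ∘ f) → Bool
  inRest X (0F , a) = false
  inRest X (fsuc i , a) = X (i , a)

  module _ (Xs : List (Fin (f 0F) → Bool)) (Ys : List (Σ (Fin k) (Fin ∘ f ∘ fsuc) → Bool)) where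

    glue : List (Σ (Fin (suc k)) (Fin ∘ f) → Bool)
    glue = map inFirst Xs ++ map inRest Ys

    glue-length : length glue ≡ length Xs + length Ys
    glue-length = trans (length-++ (map inFirst Xs)) (cong₂ _+_ (length-map inFirst Xs) (length-map inRest Ys))

    private
      split : ∀ x y {c d} → parity (map inFirst Xs) x y ≡ c → parity (map inRest Ys) x y ≡ d →
        parity glue x y ≡ c xor d
      split x y p q = trans (parity-++ (map inFirst Xs) (map inRest Ys) x y) (cong₂ _xor_ p q)

    glue-first : ∀ a b → parity glue (0F , a) (0F , b) ≡ parity Xs a b
    glue-first a b = trans (split (0F , a) (0F , b)
      (parity-map inFirst _ _ (λ _ → refl) (λ _ → refl) Xs) (parity-map-disjoint inRest _ _ (λ _ → refl) Ys))
      (xor-comm (parity Xs a b) false)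

    glue-rest : ∀ i j a b → parity glue (fsuc i , a) (fsuc j , b) ≡ parity Ys (i , a) (j , b)
    glue-rest i j a b = split (fsuc i , a) (fsuc j , b)
      (parity-map-disjoint inFirst _ _ (λ _ → refl) Xs) (parity-map inRest _ _ (λ _ → refl) (λ _ → refl) Ys)

    glue-cross : ∀ i a b → parity glue (0F , a) (fsuc i , b) ≡ false
    glue-cross i a b = split (0F , a) (fsuc i , b)
      (parity-map-disjoint inFirst _ _ (λ X → ∧-comm (X a) false) Xs)
      (parity-map-disjoint inRest _ _ (λ _ → refl) Ys)

unionFamily : (k : ℕ) (f : Fin k → ℕ) → (∀ i → List (Fin (f i) → Bool)) → List (Σ (Fin k) (Fin ∘ f) → Bool)
unionFamily zero f Xs = []
unionFamily (suc k) f Xs = Glue.glue f (Xs 0F) (unionFamily k (f ∘ fsuc) (λ i → Xs (fsuc i)))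

unionFamily-length : ∀ k f (Xs : ∀ i → List (Fin (f i) → Bool)) (g : Fin k → ℕ) → (∀ i → length (Xs i) ≡ g i) →
  length (unionFamily k f Xs) ≡ sumF k g
unionFamily-length zero f Xs g h = refl
unionFamily-length (suc k) f Xs g h = trans
  (Glue.glue-length f (Xs 0F) (unionFamily k (f ∘ fsuc) (λ i → Xs (fsuc i))))
  (cong₂ _+_ (h 0F) (unionFamily-length k (f ∘ fsuc) (λ i → Xs (fsuc i)) (g ∘ fsuc) (h ∘ fsuc)))

unionFamily-same : ∀ k f Xs i a b → parity (unionFamily k f Xs) (i , a) (i , b) ≡ parity (Xs i) a b
unionFamily-same (suc k) f Xs 0F a b = Glue.glue-first f (Xs 0F) (unionFamily k _ _) a b
unionFamily-same (suc k) f Xs (fsuc i) a b =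
  trans (Glue.glue-rest f (Xs 0F) (unionFamily k _ _) i i a b)
        (unionFamily-same k (f ∘ fsuc) (λ i → Xs (fsuc i)) i a b)

unionFamily-distinct : ∀ k f Xs {i j} a b → i ≢ j → parity (unionFamily k f Xs) (i , a) (j , b) ≡ false
unionFamily-distinct (suc k) f Xs {0F} {0F} a b i≢j = ⊥-elim (i≢j refl)
unionFamily-distinct (suc k) f Xs {0F} {fsuc j} a b i≢j = Glue.glue-cross f (Xs 0F) (unionFamily k _ _) j a b
unionFamily-distinct (suc k) f Xs {fsuc i} {0F} a b i≢j =
  trans (·-sym (signature (unionFamily (suc k) f Xs) (fsuc i , a)) _) (Glue.glue-cross f (Xs 0F) (unionFamily k _ _) i b a)
unionFamily-distinct (suc k) f Xs {fsuc i} {fsuc j} a b i≢j =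
  trans (Glue.glue-rest f (Xs 0F) (unionFamily k _ _) i j a b)
        (unionFamily-distinct k (f ∘ fsuc) (λ i → Xs (fsuc i)) a b (i≢j ∘ cong fsuc))

module _ (k : ℕ) (Ds : Fin k → Digraph) where

  private
    sizes : Fin k → ℕ
    sizes i = n (Ds i)

    Vertex : Set
    Vertex = Σ (Fin k) (Fin ∘ sizes)

    at : Fin (n (join k Ds)) → Vertex
    at = decode k sizes

  data Lex (ρ : ∀ i → Fin (sizes i) → ℕ) : Vertex → Vertex → Set where
    across : ∀ {i j a b} → toℕ i < toℕ j → Lex ρ (i , a) (j , b)
    within : ∀ {i a b} → ρ i a < ρ i b → Lex ρ (i , a) (i , b)

  lex-irrefl : ∀ {ρ x} → ¬ Lex ρ x x
  lex-irrefl (across h) = ℕ.<-irrefl refl h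
  lex-irrefl (within h) = ℕ.<-irrefl refl h

  lex-trans : ∀ {ρ x y z} → Lex ρ x y → Lex ρ y z → Lex ρ x z
  lex-trans (across p) (across q) = across (ℕ.<-trans p q)
  lex-trans (across p) (within q) = across p
  lex-trans (within p) (across q) = across q
  lex-trans (within p) (within q) = within (ℕ.<-trans p q)

  -- Each set stays inside one block, so edges between blocks keep their direction. Ordering first
  -- by block and then by a ranking of the decycled block makes all edges ascend.
  join-decycling : (Xs : ∀ i → List (Subset (Ds i))) → (∀ i → Decycling (Ds i) (Xs i)) →
    Decycling (join k Ds) (map (_∘ at) (unionFamily k sizes Xs))
  join-decycling Xs dec = acyclic⇒decycling (join k Ds) (map (_∘ at) (unionFamily k sizes Xs))
    (acyclic-of-order {R = λ x y → Lex (proj₁ ∘ ranks) (at x) (at y)} lex-irrefl lex-trans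
      λ x y h → step (at x) (at y) (trans (sym (cong₂ (λ s t → if s then t else E (join k Ds) x y)
        (parity-map (_∘ at) x y (λ _ → refl) (λ _ → refl) (unionFamily k sizes Xs)) refl)) h))
    where
    ranks : ∀ i → ∃ (Ranking (reverseIf (parity (Xs i)) (E (Ds i))))
    ranks i = topological-ranking _ _ (decycling⇒acyclic (Ds i) (Xs i) (dec i))
    step : ∀ x y → (if parity (unionFamily k sizes Xs) x y then joinEdge k Ds y x else joinEdge k Ds x y) ≡ true →
      Lex (proj₁ ∘ ranks) x y
    step (i , a) (j , b) h with i ≟ j in eq
    ... | no i≢j rewrite unionFamily-distinct k sizes Xs a b i≢j = across (<ᵇ-true⇒< h)
    ... | yes refl rewrite unionFamily-same k sizes Xs i a b | joinEdge-same k Ds i b a =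
            within (proj₂ (proj₂ (ranks i)) a b h)

-- Lower bound: an arbitrary decycling family of the join

module LowerBound (k : ℕ) (Ds : Fin k → Digraph) (Xs : List (Subset (join k Ds)))
  (ρ : Fin (n (join k Ds)) → ℕ) (ranking : Ranking (reverseIf (parity Xs) (E (join k Ds))) ρ) where

  private
    sizes : Fin k → ℕ
    sizes i = n (Ds i)

    at : ∀ i → Fin (sizes i) → Fin (n (join k Ds))
    at = encode k sizes

    F : Form (length Xs)
    F = dot (length Xs)

    edge : ∀ i j a b → E (join k Ds) (at i a) (at j b) ≡ joinEdge k Ds (i , a) (j , b)
    edge i j a b = cong₂ (joinEdge k Ds) (decode-encode k sizes i a) (decode-encode k sizes j b)

    parity-sym : ∀ u v → parity Xs u v ≡ parity Xs v u
    parity-sym u v = ·-sym (signature Xs u) (signature Xs v)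

    module Join = Reversed (E (join k Ds)) (parity Xs) parity-sym ρ ranking

  block : ∀ i → Fin (sizes i) → Point (length Xs)
  block i a = signature Xs (at i a) , ρ (at i a)

  -- All edges between two blocks run the same way, so each product is the comparison of positions
  -- or each is its negation. In a sum of two products the negations cancel.
  block-apart : ∀ {i j} → i ≢ j → Apart F (block i) (block j)
  block-apart {i} {j} i≢j a a' b with ℕ.<-cmp (toℕ i) (toℕ j)
  ... | tri< i<j _ _ = trans (cong₂ _xor_ (forward a) (forward a')) (xor-annihilates-not (block i a ≺ block j b) _)
    where
    forward : ∀ a → gram F (λ x → x) (block i a) (block j b) ≡ not (block i a ≺ block j b)
    forward a = Join.edge-targetward (at i a) (at j b)
      (trans (edge i j a b) (trans (joinEdge-distinct k Ds a b i≢j) (<⇒<ᵇ-true i<j)))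
  ... | tri≈ _ i≡j _ = ⊥-elim (i≢j (Fin.toℕ-injective i≡j))
  ... | tri> _ _ j<i = cong₂ _xor_ (backward a) (backward a')
    where
    backward : ∀ a → gram F (λ x → x) (block i a) (block j b) ≡ (block i a ≺ block j b)
    backward a = Join.edge-sourceward (at j b) (at i a)
      (trans (edge j i b a) (trans (joinEdge-distinct k Ds b a (i≢j ∘ sym)) (<⇒<ᵇ-true j<i)))

  block-mutually-apart : ∀ {i j} → i ≢ j → MutuallyApart F (block i) (block j)
  block-mutually-apart i≢j = block-apart i≢j , block-apart (i≢j ∘ sym)

  at-injective : ∀ i {a b} → at i a ≡ at i b → a ≡ b
  at-injective i {a} {b} h
    with trans (sym (decode-encode k sizes i a)) (trans (cong (decode k sizes) h) (decode-encode k sizes i b))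
  ... | refl = refl

  -- Inverting α twice changes nothing, so ρ still ranks the reversal of the inverted block along α ⊗ α + G.
  block-cyclicTriple : ∀ i (α : Subset (Ds i)) → ¬ Acyclic (invert (Ds i) α) → ∃ λ p → ∃ λ q → ∃ λ r →
    CyclicTriple (pos ∘ block i) (λ u v → (α u ∧ α v) xor gram F (block i) u v) p q r
  block-cyclicTriple i α = Reversed.cyclicTriple-exists (E (invert (Ds i) α)) G' G'-sym (pos ∘ block i)
    ((λ u v h → at-injective i (proj₁ ranking _ _ h)) , λ u v h → proj₂ ranking _ _ (trans (sym (same u v)) h))
    where
    G G' : Fin (sizes i) → Fin (sizes i) → Bool
    G = gram F (block i)
    G' u v = (α u ∧ α v) xor G u v
    G'-sym : ∀ u v → G' u v ≡ G' v u
    G'-sym u v = cong₂ _xor_ (∧-comm (α u) (α v)) (parity-sym (at i u) (at i v))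
    cancel : ∀ a b → a xor (a xor b) ≡ b
    cancel false b = refl
    cancel true b = not-involutive b
    same : ∀ u v → reverseIf G' (E (invert (Ds i) α)) u v ≡ reverseIf (parity Xs) (E (join k Ds)) (at i u) (at i v)
    same u v = trans (reverseIf-invert (E (Ds i)) G' α u v)
      (trans (cong (if_then E (Ds i) v u else E (Ds i) u v) (cancel (α u ∧ α v) (G u v)))
        (cong₂ (if parity Xs (at i u) (at i v) then_else_)
          (sym (trans (edge i i v u) (joinEdge-same k Ds i v u)))
          (sym (trans (edge i i u v) (joinEdge-same k Ds i u v)))))

  module _ (invs : Fin k → ℕ) (hasInv : ∀ i → IsInv (Ds i) (invs i)) (invs≤2 : ∀ i → invs i ≤ 2)
    (unique2 : ∀ i j → invs i ≡ 2 → invs j ≡ 2 → i ≡ j) where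

    Single : Fin k → Set
    Single i = invs i ≡ 1

    InBlock : Fin k → Triple (length Xs) → Set
    InBlock i τ = ∃ λ p → ∃ λ q → ∃ λ r → τ ≡ triple (block i) p q r

    cyclic-invert : ∀ i → invs i ≡ 2 → ∀ α → ¬ Acyclic (invert (Ds i) α)
    cyclic-invert i eq α ac with subst (_≤ 1) eq (proj₂ (hasInv i) (α ∷ []) ac)
    ... | s≤s ()

    cyclic : ∀ i → 1 ≤ invs i → ¬ Acyclic (Ds i)
    cyclic i 1≤ ac = ℕ.<⇒≱ 1≤ (proj₂ (hasInv i) [] ac)

    block-triple : ∀ i → 1 ≤ invs i → ∃ λ τ → Cyclic F τ × InBlock i τ
    block-triple i 1≤ with block-cyclicTriple i (λ _ → false) (cyclic i 1≤)
    ... | p , q , r , c = triple (block i) p q r , triple-cyclic F (block i) c , p , q , r , refl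

    inBlock-apart : ∀ {J : Set} {j τ} (g : J → Point (length Xs)) → InBlock j τ →
      MutuallyApart F (block j) g → MutuallyApart F τ g
    inBlock-apart {j = j} g (p , q , r , refl) = triple-apart F p q r (block j) g

    apart-inBlock : ∀ {i j τ} → i ≢ j → InBlock j τ → MutuallyApart F (block i) τ
    apart-inBlock {i} i≢j inj =
      let (a , b) = inBlock-apart (block i) inj (block-mutually-apart (i≢j ∘ sym)) in b , a

    -- The origin of each triple is recorded: it gives apartness from blocks added later and from
    -- the block of inversion number 2.
    SortedTriplesIn : {l : ℕ} → (Fin l → Fin k) → ℕ → Set
    SortedTriplesIn g c = ∃ λ τs → Sorted F τs × All (Cyclic F) τs ×
      All (λ τ → ∃ λ i → Single (g i) × InBlock (g i) τ) τs × length τs ≡ c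

    -- The right case sets aside the block of inversion number 2, which accounts for the 2 in the
    -- sum; all other units of the sum come with a triple.
    Collected : {l : ℕ} → (Fin l → Fin k) → ℕ → Set
    Collected g s = SortedTriplesIn g s ⊎
      ∃ λ i → invs (g i) ≡ 2 × ∃ λ c → 2 + c ≡ s × SortedTriplesIn g c

    shift : ∀ {l c} {g : Fin (suc l) → Fin k} → SortedTriplesIn (g ∘ fsuc) c → SortedTriplesIn g c
    shift (τs , s , c , ins , len) = τs , s , c , All.map (λ { (i , h) → fsuc i , h }) ins , len

    add-triple : ∀ {l c} {g : Fin (suc l) → Fin k} → (∀ {i j} → g i ≡ g j → i ≡ j) → invs (g 0F) ≡ 1 →
      SortedTriplesIn (g ∘ fsuc) c → SortedTriplesIn g (suc c)
    add-triple {g = g} g-inj one (τs , ss , cs , ins , len)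
      with τ , c , in₀ ← block-triple (g 0F) (ℕ.≤-reflexive (sym one))
      with τs' , ss' , len' , all ← insert F τ
             (All.map (λ { {σ} (i , _ , inᵢ) → inBlock-apart σ in₀
               (apart-inBlock (λ h → Fin.0≢1+n (g-inj h)) inᵢ) }) ins) ss
      = τs' , ss' , all c cs
      , all (0F , one , in₀) (All.map (λ { (i , h) → fsuc i , h }) ins) , trans len' (cong suc len)

    -- The join stays fixed while the recursion drops blocks, hence the reindexing `g`; its
    -- injectivity keeps the blocks distinct.
    collect : ∀ l (g : Fin l → Fin k) → (∀ {i j} → g i ≡ g j → i ≡ j) → Collected g (sumF l (invs ∘ g))
    collect zero g g-inj = inj₁ ([] , [] , [] , [] , refl)
    collect (suc l) g g-inj
      with invs (g 0F) in eq | invs≤2 (g 0F) | collect l (g ∘ fsuc) (Fin.suc-injective ∘ g-inj)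
    ... | 0 | _ | inj₁ t = inj₁ (shift t)
    ... | 0 | _ | inj₂ (i , two , c , len , t) = inj₂ (fsuc i , two , c , len , shift t)
    ... | 1 | _ | inj₁ t = inj₁ (add-triple g-inj eq t)
    ... | 1 | _ | inj₂ (i , two , c , len , t) =
            inj₂ (fsuc i , two , suc c , cong suc len , add-triple g-inj eq t)
    ... | 2 | _ | inj₁ t = inj₂ (0F , eq , _ , refl , shift t)
    ... | 2 | _ | inj₂ (i , two , _) = ⊥-elim (Fin.0≢1+n (g-inj (unique2 _ _ eq two)))
    ... | suc (suc (suc _)) | s≤s (s≤s ()) | _

    -- If one block has inversion number 2, a triple from it added to the `c` others gives `c` + 1
    -- as a lower bound, and `twiceCyclic-rank` excludes equality.
    lower-bound : sumF k invs ≤ length Xs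
    lower-bound with collect k (λ i → i) (λ h → h)
    ... | inj₁ (τs , ss , cs , _ , len) = subst (_≤ length Xs) len (sorted-length F (dot-rank _) cs ss)
    ... | inj₂ (i , two , c , eq , τs , ss , cs , ins , len)
      = subst (_≤ length Xs) (trans (cong (2 +_) len) eq) (ℕ.≤∧≢⇒< one-less not-equal)
      where
      aparts : All (MutuallyApart F (block i)) τs
      aparts = All.map (λ { (j , one , inⱼ) →
        apart-inBlock (λ { refl → ℕ.0≢1+n (ℕ.suc-injective (trans (sym one) two)) }) inⱼ }) ins
      one-less : suc (length τs) ≤ length Xs
      one-less with τ , c , inᵢ ← block-triple i (subst (1 ≤_) (sym two) (s≤s z≤n))
        with τs' , ss' , len' , all ← insert F τ
               (All.map (λ {σ} a → inBlock-apart σ inᵢ a) aparts) ss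
        = subst (_≤ length Xs) len' (sorted-length F (dot-rank _) (all c cs) ss')
      not-equal : suc (length τs) ≢ length Xs
      not-equal h = twiceCyclic-rank (block i) (gram F (block i))
        (λ α → block-cyclicTriple i α (cyclic-invert i two α)) F τs
        (subst (RankAtMost F) (sym h) (dot-rank _)) (λ _ _ → refl) cs ss aparts

theorem1p4 : (k : ℕ) (Ds : Fin k → Digraph) (invs : Fin k → ℕ)
    → (∀ i → Oriented (Ds i))
    → (∀ i → IsInv (Ds i) (invs i))
    → (∀ i → invs i ≤ 2)
    → (∀ i j → invs i ≡ 2 → invs j ≡ 2 → i ≡ j)
    → IsInv (join k Ds) (sumF k invs)
theorem1p4 k Ds invs _ hasInv invs≤2 unique2 =
  (map (_∘ decode k sizes) (unionFamily k sizes Xs)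
    , trans (length-map _ (unionFamily k sizes Xs))
        (unionFamily-length k sizes Xs invs (λ i → proj₁ (proj₂ (proj₁ (hasInv i)))))
    , join-decycling k Ds Xs (λ i → proj₂ (proj₂ (proj₁ (hasInv i)))))
  , λ Ys dec → let (ρ , ranking) = topological-ranking _ _ (decycling⇒acyclic (join k Ds) Ys dec) in
      LowerBound.lower-bound k Ds Ys ρ ranking invs hasInv invs≤2 unique2
  where
  sizes = λ i → n (Ds i)
  Xs = λ i → proj₁ (proj₁ (hasInv i))
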